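{- Let $T$ be a tree on $n\geq 8$ vertices. Let $k$ and $i$ be integers with $0\leq i\leq 2k$ and $2n-1=k^2+i$. For any leaf $u$ of $T$, \[\frac{\operatorname{Ecc}(T)}{\operatorname{ecc}_T(u)} \leq \begin{cases} 2n+1-2k-\frac{i}{k} & \text{if } 0\leq i\leq k,\\ 2n+1-2k-\frac{i+1}{k+1} & \text{if } k+1\leq i\leq 2k.\end{cases}\] Equality holds if and only if $T$ has a longest path $P=z_1z_2\ldots z_{2x-1}$ (where $x=k$ in the first case and $x=k+1$ in the second case), the leaf $u$ is adjacent to $z_x$, and every other vertex not on $P$ is adjacent to either $z_2$ or $z_{2x-2}$. For $i=k$ the two bounds agree and both values of $x$ give an extremal tree.
   Context: For a vertex $v$ of a tree $T$, $\operatorname{ecc}_T(v)=\max_{w\in V(T)} d_T(v,w)$. The total eccentricity is $\operatorname{Ecc}(T)=\sum_{z\in V(T)}\operatorname{ecc}_T(z)$. A leaf is a vertex of degree 1. -}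

module Defs where

open import Data.Nat using (ℕ; zero; suc; _+_; _*_; _∸_; _≤_; _<_)
open import Data.Fin using (Fin)
open import Data.Bool using (Bool; true; false; if_then_else_)
open import Data.List using (List; map; allFin)
open import Data.Nat.ListAction using (sum)
open import Data.Product using (Σ; ∃; _×_; _,_)
open import Data.Sum using (_⊎_)
open import Relation.Binary.PropositionalEquality using (_≡_; _≢_)
open import Relation.Nullary using (¬_)

record Graph (n : ℕ) : Set where
  field
    adj     : Fin n → Fin n → Bool
    adj-sym : ∀ v w → adj v w ≡ adj w v
    adj-irr : ∀ v → adj v v ≡ false
open Graph public

module _ {n : ℕ} (G : Graph n) where

  Adj : Fin n → Fin n → Set
  Adj v w = adj G v w ≡ true

  data Walk : Fin n → Fin n → ℕ → Set where
    here : ∀ {v} → Walk v v 0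
    step : ∀ {v w t ℓ} → Adj v w → Walk w t ℓ → Walk v t (suc ℓ)

  IsDist : Fin n → Fin n → ℕ → Set
  IsDist v w d = Walk v w d × (∀ ℓ → Walk v w ℓ → d ≤ ℓ)

  IsEcc : Fin n → ℕ → Set
  IsEcc v e = (∃ λ w → IsDist v w e) × (∀ w d → IsDist v w d → d ≤ e)

  -- A path with m vertices z 1, z 2, …, z m (1-indexed): distinct vertices,
  -- consecutive ones adjacent.
  IsPath : ℕ → (ℕ → Fin n) → Set
  IsPath m z =
    (∀ a b → 1 ≤ a → a ≤ m → 1 ≤ b → b ≤ m → z a ≡ z b → a ≡ b) ×
    (∀ a → 1 ≤ a → a < m → Adj (z a) (z (suc a)))

  OnPath : ℕ → (ℕ → Fin n) → Fin n → Set
  OnPath m z v = ∃ λ a → 1 ≤ a × a ≤ m × z a ≡ v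

  IsLongestPath : ℕ → (ℕ → Fin n) → Set
  IsLongestPath m z = IsPath m z × (∀ m' z' → IsPath m' z' → m' ≤ m)

  Connected : Set
  Connected = ∀ v w → ∃ λ ℓ → Walk v w ℓ

  Acyclic : Set
  Acyclic = ∀ m z → 3 ≤ m → IsPath m z → ¬ Adj (z m) (z 1)

  IsTree : Set
  IsTree = Connected × Acyclic

  degree : Fin n → ℕ
  degree v = sum (map (λ w → if adj G v w then 1 else 0) (allFin n))

  IsLeaf : Fin n → Set
  IsLeaf v = degree v ≡ 1

  totalEcc : (Fin n → ℕ) → ℕ
  totalEcc ecc = sum (map ecc (allFin n))

  Extremal : Fin n → ℕ → Set
  Extremal u x = Σ (ℕ → Fin n) λ z →
    IsLongestPath (2 * x ∸ 1) z ×
    Adj u (z x) ×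
    (∀ v → v ≢ u → ¬ OnPath (2 * x ∸ 1) z v →
       Adj v (z 2) ⊎ Adj v (z (2 * x ∸ 2)))

{-# OPTIONS --safe #-}

-- Let e = ecc u and let D be the diameter. In a tree the distance to a fixed vertex
-- first falls and then rises along any path, so the vertices of a diametral path have
-- eccentricities max(j, D − j). The neighbour of the leaf u has eccentricity at most
-- e − 1, whence D ≤ 2(e − 1). Bounding all remaining eccentricities by D gives
-- Ecc(T) ≤ nD − ⌊D²/4⌋ − (D − e), which increases in D up to D = 2(e − 1), where it is
-- (2n + 1)e − e² − (2n − 1). Dividing by e leaves 2n + 1 − (e + (2n − 1)/e), maximal
-- over the integers exactly at e = x. Equality forces D = 2(x − 1) and eccentricity D
-- at every vertex other than u off the path, which is the extremal shape. The two
-- values of x never compete: i = k would make 2n odd.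
module Submission where

open import Defs
open import Data.Bool using (true; if_then_else_)
import Data.Bool.Properties as Bool
open import Data.Fin using (Fin; zero; suc)
import Data.Fin.Properties as Fin
open import Data.List using (List; []; _∷_; _++_; map; allFin; applyUpTo; length; filter)
open import Data.List.Membership.Propositional using (_∈_; _∉_)
open import Data.List.Membership.Propositional.Properties using (∈-++⁺ˡ; ∈-++⁺ʳ; ∈-allFin; ∈-filter⁺; ∈-filter⁻; ∈-applyUpTo⁺; ∈-applyUpTo⁻)
open import Data.List.Membership.Propositional.Properties.WithK using (unique∧set⇒bag)
open import Data.List.Properties using (map-++; length-++; length-tabulate; length-applyUpTo; map-applyUpTo; applyUpTo-∷ʳ)
open import Data.List.Relation.Binary.BagAndSetEquality using (∼bag⇒↭)
open import Data.List.Relation.Binary.Permutation.Propositional using (_↭_)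
open import Data.List.Relation.Binary.Permutation.Propositional.Properties using (↭-length; map⁺)
open import Data.List.Relation.Unary.All using ([]; _∷_)
import Data.List.Relation.Unary.All.Properties as All
open import Data.List.Relation.Unary.AllPairs using ([]; _∷_)
open import Data.List.Relation.Unary.Any using (here; there)
open import Data.List.Relation.Unary.Unique.Propositional using (Unique)
open import Data.List.Relation.Unary.Unique.Propositional.Properties using (++⁺; filter⁺; allFin⁺; applyUpTo⁺₁)
open import Data.Nat
open import Data.Nat.ListAction using (sum)
open import Data.Nat.ListAction.Properties using (sum-++; sum-↭)
open import Data.Nat.Properties
open import Data.Nat.Tactic.RingSolver using (solve-∀)
open import Data.Product using (∃; _×_; _,_; proj₁; proj₂)
open import Data.Sum using (_⊎_; inj₁; inj₂)
import Data.Sum as Sum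
open import Function using (_∘_; mk⇔)
open import Function.Bundles using (_⇔_)
open import Function.Construct.Composition using (_⇔-∘_)
open import Relation.Binary.Definitions using (tri<; tri≈; tri>)
open import Relation.Binary.PropositionalEquality
open import Relation.Nullary using (¬_; Dec; yes; no; contradiction)
open import Relation.Nullary.Decidable using (map′; _×-dec_)

-- Walks and paths

least : ∀ {P : ℕ → Set} → (∀ ℓ → Dec (P ℓ)) → ∀ m → P m → ∃ λ d → P d × (∀ ℓ → P ℓ → d ≤ ℓ)
least P? zero p = 0 , p , λ _ _ → z≤n
least P? (suc m) p with P? 0
... | yes p₀ = 0 , p₀ , λ _ _ → z≤n
... | no ¬p₀ with d , q , min ← least (P? ∘ suc) m p =
  suc d , q , λ { zero p₀ → contradiction p₀ ¬p₀ ; (suc ℓ) r → s≤s (min ℓ r) }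

module Walks {n : ℕ} (G : Graph n) where

  _~_ : Fin n → Fin n → Set
  _~_ = Adj G

  ~-sym : ∀ {v w} → v ~ w → w ~ v
  ~-sym {v} {w} e = trans (adj-sym G w v) e

  ~⇒≢ : ∀ {v w} → v ~ w → v ≢ w
  ~⇒≢ {v} e refl with () ← trans (sym e) (adj-irr G v)

  walk? : ∀ ℓ v w → Dec (Walk G v w ℓ)
  walk? zero v w = map′ (λ { refl → here }) (λ { here → refl }) (v Fin.≟ w)
  walk? (suc ℓ) v w =
    map′ (λ { (x , e , p) → step e p }) (λ { (step e p) → _ , e , p })
         (Fin.any? λ x → (adj G v x Bool.≟ true) ×-dec walk? ℓ x w)

  _++ʷ_ : ∀ {v w t k ℓ} → Walk G v w k → Walk G w t ℓ → Walk G v t (k + ℓ)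
  here     ++ʷ q = q
  step e p ++ʷ q = step e (p ++ʷ q)

  reverseʷ : ∀ {v w ℓ} → Walk G v w ℓ → Walk G w v ℓ
  reverseʷ here = here
  reverseʷ {w = w} (step {ℓ = ℓ} e p) =
    subst (Walk G w _) (+-comm ℓ 1) (reverseʷ p ++ʷ step (~-sym e) here)

  -- Indices beyond the length return the last vertex, which keeps the function total.
  vertex : ∀ {v w ℓ} → Walk G v w ℓ → ℕ → Fin n
  vertex {v} here       _       = v
  vertex {v} (step e p) zero    = v
  vertex     (step e p) (suc j) = vertex p j

  vertex-first : ∀ {v w ℓ} (p : Walk G v w ℓ) → vertex p 0 ≡ v
  vertex-first here       = refl
  vertex-first (step _ _) = refl

  vertex-last : ∀ {v w ℓ} (p : Walk G v w ℓ) → vertex p ℓ ≡ w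
  vertex-last here       = refl
  vertex-last (step _ p) = vertex-last p

  vertex-edge : ∀ {v w ℓ} (p : Walk G v w ℓ) {j} → j < ℓ → vertex p j ~ vertex p (suc j)
  vertex-edge (step e p) {zero}  _         = subst (_ ~_) (sym (vertex-first p)) e
  vertex-edge (step e p) {suc j} (s≤s j<ℓ) = vertex-edge p j<ℓ

  -- The path q 0, q 1, …, q m: unlike in IsPath, m counts edges and indices start at 0.
  record Path (m : ℕ) (q : ℕ → Fin n) : Set where
    field
      inj  : ∀ {a b} → a ≤ m → b ≤ m → q a ≡ q b → a ≡ b
      edge : ∀ {a} → a < m → q a ~ q (suc a)
  open Path public

  fromIsPath : ∀ {m z} → IsPath G (suc m) z → Path m (z ∘ suc)
  fromIsPath (i , e) .inj a≤m b≤m eq = suc-injective (i _ _ (s≤s z≤n) (s≤s a≤m) (s≤s z≤n) (s≤s b≤m) eq)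
  fromIsPath (i , e) .edge a<m = e _ (s≤s z≤n) (s≤s a<m)

  toIsPath : ∀ {m q} → Path m q → IsPath G (suc m) (q ∘ pred)
  toIsPath P .proj₁ (suc a) (suc b) _ a≤m _ b≤m eq = cong suc (inj P (s≤s⁻¹ a≤m) (s≤s⁻¹ b≤m) eq)
  toIsPath P .proj₂ (suc a) _ a<m = edge P (s≤s⁻¹ a<m)

  reverseᵖ : ∀ {m q} → Path m q → Path m (λ a → q (m ∸ a))
  reverseᵖ {m} P .inj {a} {b} a≤m b≤m eq = ∸-cancelˡ-≡ a≤m b≤m (inj P (m∸n≤m m a) (m∸n≤m m b) eq)
  reverseᵖ {m} {q} P .edge {a} a<m =
    ~-sym (subst (q (m ∸ suc a) ~_) (cong q (sym (+-∸-assoc 1 a<m)))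
                 (edge P (subst (_≤ m) (+-∸-assoc 1 a<m) (m∸n≤m m a))))

  cons : Fin n → (ℕ → Fin n) → ℕ → Fin n
  cons v q zero    = v
  cons v q (suc a) = q a

  consᵖ : ∀ {m q v} → v ~ q 0 → (∀ {a} → a ≤ m → q a ≢ v) → Path m q → Path (suc m) (cons v q)
  consᵖ e fresh P .inj {zero}  {zero}  _ _ _ = refl
  consᵖ e fresh P .inj {zero}  {suc b} _ b≤m eq = contradiction (sym eq) (fresh (s≤s⁻¹ b≤m))
  consᵖ e fresh P .inj {suc a} {zero}  a≤m _ eq = contradiction eq (fresh (s≤s⁻¹ a≤m))
  consᵖ e fresh P .inj {suc a} {suc b} a≤m b≤m eq = cong suc (inj P (s≤s⁻¹ a≤m) (s≤s⁻¹ b≤m) eq)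
  consᵖ e fresh P .edge {zero}  _   = e
  consᵖ e fresh P .edge {suc a} a<m = edge P (s≤s⁻¹ a<m)

-- The metric of a tree

module TreeMetric {n : ℕ} (T : Graph n) (tree : IsTree T) where
  open Walks T public

  private
    shortest : ∀ v w → ∃ (IsDist T v w)
    shortest v w with ℓ , p ← proj₁ tree v w = least (λ ℓ → walk? ℓ v w) ℓ p

  d : Fin n → Fin n → ℕ
  d v w = proj₁ (shortest v w)

  d-isDist : ∀ v w → IsDist T v w (d v w)
  d-isDist v w = proj₂ (shortest v w)

  geodesic : ∀ v w → Walk T v w (d v w)
  geodesic v w = proj₁ (d-isDist v w)

  d-min : ∀ {v w ℓ} → Walk T v w ℓ → d v w ≤ ℓ
  d-min {v} {w} = proj₂ (d-isDist v w) _

  isDist⇒≡d : ∀ {v w ℓ} → IsDist T v w ℓ → ℓ ≡ d v w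
  isDist⇒≡d (p , min) = ≤-antisym (min _ (geodesic _ _)) (d-min p)

  d-refl : ∀ v → d v v ≡ 0
  d-refl v = n≤0⇒n≡0 (d-min here)

  d≡0⇒≡ : ∀ {v w} → d v w ≡ 0 → v ≡ w
  d≡0⇒≡ {v} {w} eq with here ← subst (Walk T v w) eq (geodesic v w) = refl

  d-sym : ∀ v w → d v w ≡ d w v
  d-sym v w = ≤-antisym (d-min (reverseʷ (geodesic w v))) (d-min (reverseʷ (geodesic v w)))

  d-triangle : ∀ v w t → d v t ≤ d v w + d w t
  d-triangle v w t = d-min (geodesic v w ++ʷ geodesic w t)

  ~⇒d≤ : ∀ {v v′} → v ~ v′ → ∀ w → d v w ≤ suc (d v′ w)
  ~⇒d≤ e w = d-min (step e (geodesic _ w))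

  -- The first step of a shortest walk: what remains has length `L`, and an edge lowers the distance
  -- by at most one.
  parent : ∀ {v w L} → d v w ≡ suc L → ∃ λ v′ → v ~ v′ × d v′ w ≡ L
  parent {v} {w} eq with step {w = v′} e p ← subst (Walk T v w) eq (geodesic v w) =
    v′ , e , ≤-antisym (d-min p) (s≤s⁻¹ (subst (_≤ _) eq (~⇒d≤ e w)))

  -- With `2 + m` edges the path has at least three vertices, as `Acyclic` demands.
  acyclicᵖ : ∀ {m q} → Path (2 + m) q → ¬ (q (2 + m) ~ q 0)
  acyclicᵖ P = proj₂ tree _ _ (s≤s (s≤s (s≤s z≤n))) (toIsPath P)

  private
    -- The bound `low` makes extension safe: a vertex at distance `suc L` from `w` cannot already
    -- lie on the route.
    record Link (w : Fin n) (L m : ℕ) (b c : Fin n) : Set where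
      field
        route : ℕ → Fin n
        path  : Path m route
        first : route 0 ≡ b
        last  : route m ≡ c
        low   : ∀ {a} → a ≤ m → d (route a) w ≤ L
    open Link

    pointᴸ : ∀ w b → Link w (d b w) 0 b b
    pointᴸ w b .route _ = b
    pointᴸ w b .path .inj z≤n z≤n _ = refl
    pointᴸ w b .path .edge ()
    pointᴸ w b .first = refl
    pointᴸ w b .last = refl
    pointᴸ w b .low _ = ≤-refl

    reverseᴸ : ∀ {w L m b c} → Link w L m b c → Link w L m c b
    reverseᴸ {m = m} l .route a = l .route (m ∸ a)
    reverseᴸ l .path = reverseᵖ (l .path)
    reverseᴸ l .first = l .last
    reverseᴸ {m = m} l .last = trans (cong (l .route) (n∸n≡0 m)) (l .first)
    reverseᴸ {m = m} l .low {a} _ = l .low (m∸n≤m m a)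

    consᴸ : ∀ {w L L′ m b c v} (l : Link w L m b c) → v ~ b → (∀ {a} → a ≤ m → l .route a ≢ v) →
            L ≤ L′ → d v w ≤ L′ → Link w L′ (suc m) v c
    consᴸ {v = v} l e fresh L≤L′ v≤L′ .route = cons v (l .route)
    consᴸ {v = v} l e fresh L≤L′ v≤L′ .path = consᵖ (subst (v ~_) (sym (l .first)) e) fresh (l .path)
    consᴸ l e fresh L≤L′ v≤L′ .first = refl
    consᴸ l e fresh L≤L′ v≤L′ .last = l .last
    consᴸ l e fresh L≤L′ v≤L′ .low {zero} _ = v≤L′
    consᴸ l e fresh L≤L′ v≤L′ .low {suc a} a≤m = ≤-trans (l .low (s≤s⁻¹ a≤m)) L≤L′

    above : ∀ {w L m b c v} (l : Link w L m b c) → d v w ≡ suc L → ∀ {a} → a ≤ m → l .route a ≢ v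
    above l eq a≤m refl = 1+n≰n (subst (_≤ _) eq (l .low a≤m))

    -- Both ends are extended by prepending `b`, reversing, prepending `c` and reversing back.
    wrapᴸ : ∀ {w L m b b′ c c′} → b ≢ c → b ~ b′ → c ~ c′ → d b w ≡ suc L → d c w ≡ suc L →
            Link w L m b′ c′ → Link w (suc L) (2 + m) b c
    wrapᴸ {w} {L} {m} {b} {c = c} b≢c b~ c~ db dc l =
      reverseᴸ (consᴸ (reverseᴸ (consᴸ l b~ (above l db) (n≤1+n _) (≤-reflexive db)))
                      c~ fresh ≤-refl (≤-reflexive dc))
      where
      consq : ∀ j → j ≤ suc m → cons b (l .route) j ≢ c
      consq zero _ = b≢c
      consq (suc j) j≤m = above l dc (s≤s⁻¹ j≤m)
      fresh : ∀ {a} → a ≤ suc m → cons b (l .route) (suc m ∸ a) ≢ c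
      fresh {a} _ = consq (suc m ∸ a) (m∸n≤m (suc m) a)

    -- Climbing down towards w from both vertices until the two descents meet.
    level-link : ∀ {w} L {b c} → b ≢ c → d b w ≡ L → d c w ≡ L → ∃ λ m → Link w L (2 + m) b c
    level-link zero b≢c db dc = contradiction (trans (d≡0⇒≡ db) (sym (d≡0⇒≡ dc))) b≢c
    level-link {w} (suc L) b≢c db dc with parent db | parent dc
    ... | b′ , b~ , db′ | c′ , c~ , dc′ with b′ Fin.≟ c′
    ... | yes refl = _ , wrapᴸ b≢c b~ c~ db dc (subst (λ L → Link w L 0 b′ b′) db′ (pointᴸ w b′))
    ... | no b′≢c′ = _ , wrapᴸ b≢c b~ c~ db dc (proj₂ (level-link L b′≢c′ db′ dc′))

  -- Otherwise the link between the ends, which has at least two edges, would be closed to a cycle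
  -- by the edge itself.
  ~⇒d≢ : ∀ {a b} → a ~ b → ∀ w → d a w ≢ d b w
  ~⇒d≢ e w eq with m , l ← level-link _ (~⇒≢ e) eq refl =
    acyclicᵖ (l .path) (subst₂ _~_ (sym (l .last)) (sym (l .first)) (~-sym e))

  -- Two distinct parents would be joined by a link strictly nearer to `w` than `a`, and `a` would
  -- close it to a cycle.
  parent-unique : ∀ {a b c w} → a ~ b → a ~ c → d a w ≡ suc (d b w) → d a w ≡ suc (d c w) → b ≡ c
  parent-unique {a} {b} {c} {w} a~b a~c ab ac with b Fin.≟ c
  ... | yes b≡c = b≡c
  ... | no b≢c with m , l ← level-link (d b w) b≢c refl (suc-injective (trans (sym ac) ab)) =
    contradiction (subst (_~ a) (sym (l .last)) (~-sym a~c))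
      (acyclicᵖ (consᵖ (subst (a ~_) (sym (l .first)) a~b) (above l ab) (l .path)))

  ~⇒d±1 : ∀ {a b} → a ~ b → ∀ w → d b w ≡ suc (d a w) ⊎ d a w ≡ suc (d b w)
  ~⇒d±1 {a} {b} e w with <-cmp (d a w) (d b w)
  ... | tri< lt _ _ = inj₁ (≤-antisym (~⇒d≤ (~-sym e) w) lt)
  ... | tri≈ _ eq _ = contradiction eq (~⇒d≢ e w)
  ... | tri> _ _ gt = inj₂ (≤-antisym (~⇒d≤ e w) gt)

  -- Along a path the distance to a fixed vertex first falls, then rises: at an
  -- interior peak the two neighbours would both be the parent.
  module _ {m q} (P : Path m q) where

    no-peak : ∀ {a} w → 2 + a ≤ m → d (q (suc a)) w ≡ suc (d (q a) w) →
              d (q (suc a)) w ≢ suc (d (q (2 + a)) w)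
    no-peak {a} w 2+a≤m up down =
      m≢1+n+m a (inj P (≤-trans (m≤n+m a 2) 2+a≤m) 2+a≤m
        (parent-unique (~-sym (edge P (≤-trans (n≤1+n _) 2+a≤m))) (edge P 2+a≤m) up down))

    ascend-step : ∀ {a w} → d (q (suc a)) w ≡ suc (d (q a) w) →
                  ∀ t → suc (t + a) ≤ m → d (q (suc (t + a))) w ≡ suc (d (q (t + a)) w)
    ascend-step up zero _ = up
    ascend-step {a} {w} up (suc t) le with ~⇒d±1 (edge P le) w
    ... | inj₁ eq = eq
    ... | inj₂ eq = contradiction eq (no-peak w le (ascend-step up t (≤-trans (n≤1+n _) le)))

    ascend : ∀ {a w} → d (q (suc a)) w ≡ suc (d (q a) w) →
             ∀ t → t + a ≤ m → d (q (t + a)) w ≡ t + d (q a) w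
    ascend up zero _ = refl
    ascend up (suc t) le = trans (ascend-step up t le) (cong suc (ascend up t (≤-trans (n≤1+n _) le)))

    descend : ∀ {a w} → a < m → d (q a) w ≡ suc (d (q (suc a)) w) → d (q 0) w ≡ a + d (q a) w
    descend {zero} _ _ = refl
    descend {suc a} {w} a<m down with ~⇒d±1 (edge P (≤-trans (n≤1+n _) a<m)) w
    ... | inj₁ eq = contradiction down (no-peak w a<m eq)
    ... | inj₂ eq = trans (descend (≤-trans (n≤1+n _) a<m) eq) (trans (cong (a +_) eq) (+-suc a _))

    -- From `q a`, at distance 0 from itself, the first step can only rise, so the path rises
    -- throughout: every path in a tree is a geodesic.
    path-dist : ∀ a t → t + a ≤ m → d (q (t + a)) (q a) ≡ t
    path-dist a zero _ = d-refl (q a)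
    path-dist a (suc t) le with ~⇒d±1 (edge P (≤-trans (s≤s (m≤n+m a t)) le)) (q a)
    ... | inj₁ up = trans (ascend up (suc t) le) (trans (cong (suc t +_) (d-refl (q a))) (+-identityʳ _))
    ... | inj₂ eq with () ← trans (sym (d-refl (q a))) eq

  -- The vertices are told apart by their distance from `v`. The bounds counted from the two ends
  -- add up to `d v w`, so the triangle inequality makes them exact.
  geodesic-path : ∀ v w → Path (d v w) (vertex (geodesic v w))
  geodesic-path v w = record
    { inj = λ {a} {b} a≤ b≤ eq → trans (sym (level a≤)) (trans (cong (d v) eq) (level b≤))
    ; edge = vertex-edge W }
    where
    W = geodesic v w
    q = vertex W
    from-first : ∀ {j} → j ≤ d v w → d (q j) v ≤ j
    from-first {zero} _ = ≤-reflexive (trans (cong (λ x → d x v) (vertex-first W)) (d-refl v))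
    from-first {suc j} le = ≤-trans (~⇒d≤ (~-sym (vertex-edge W le)) v) (s≤s (from-first (≤-trans (n≤1+n _) le)))
    to-last : ∀ t {j} → t + j ≡ d v w → d (q j) w ≤ t
    to-last zero refl = ≤-reflexive (trans (cong (λ x → d x w) (vertex-last W)) (d-refl w))
    to-last (suc t) {j} eq =
      ≤-trans (~⇒d≤ (vertex-edge W (subst (suc j ≤_) eq (s≤s (m≤n+m j t)))) w)
              (s≤s (to-last t (trans (+-suc t j) eq)))
    level : ∀ {j} → j ≤ d v w → d v (q j) ≡ j
    level {j} le = ≤-antisym (subst (_≤ j) (d-sym (q j) v) (from-first le))
      (+-cancelʳ-≤ (d v w ∸ j) j (d v (q j)) (begin
        j + (d v w ∸ j)              ≡⟨ m+[n∸m]≡n le ⟩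
        d v w                        ≤⟨ d-triangle v (q j) w ⟩
        d v (q j) + d (q j) w        ≤⟨ +-monoʳ-≤ _ (to-last (d v w ∸ j) (m∸n+n≡m le)) ⟩
        d v (q j) + (d v w ∸ j)      ∎))
      where open ≤-Reasoning

-- Sums over vertices

third : ∀ {n} → 3 ≤ n → (u v : Fin n) → ∃ λ w → w ≢ u × w ≢ v
third (s≤s (s≤s (s≤s _))) zero          zero          = suc zero , (λ ()) , (λ ())
third (s≤s (s≤s (s≤s _))) zero          (suc zero)    = suc (suc zero) , (λ ()) , (λ ())
third (s≤s (s≤s (s≤s _))) zero          (suc (suc _)) = suc zero , (λ ()) , (λ ())
third (s≤s (s≤s (s≤s _))) (suc zero)    zero          = suc (suc zero) , (λ ()) , (λ ())
third (s≤s (s≤s (s≤s _))) (suc (suc _)) zero          = suc zero , (λ ()) , (λ ())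
third (s≤s (s≤s (s≤s _))) (suc _)       (suc _)       = zero , (λ ()) , (λ ())

maximum : ∀ {n} → Fin n → (f : Fin n → ℕ) → ∃ λ v → ∀ w → f w ≤ f v
maximum {suc zero} _ f = zero , λ { zero → ≤-refl }
maximum {suc (suc n)} _ f with v , max ← maximum zero (f ∘ suc) | ≤-total (f zero) (f (suc v))
... | inj₁ le = suc v , λ { zero → le ; (suc w) → max w }
... | inj₂ ge = zero , λ { zero → ≤-refl ; (suc w) → ≤-trans (max w) ge }

module _ {n : ℕ} where
  open import Data.List.Membership.DecPropositional (Fin._≟_ {n}) using (_∈?_; _∉?_) public

  others : List (Fin n) → List (Fin n)
  others xs = filter (_∉? xs) (allFin n)

  ∈-others⁺ : ∀ {v xs} → v ∉ xs → v ∈ others xs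
  ∈-others⁺ {v} {xs} v∉xs = ∈-filter⁺ (_∉? xs) (∈-allFin v) v∉xs

  ∈-others⁻ : ∀ {v xs} → v ∈ others xs → v ∉ xs
  ∈-others⁻ {xs = xs} v∈ = proj₂ (∈-filter⁻ (_∉? xs) {xs = allFin n} v∈)

  -- Both lists are free of repetitions, so having the same members already makes them permutations
  -- of each other.
  allFin↭ : ∀ {xs} → Unique xs → allFin n ↭ xs ++ others xs
  allFin↭ {xs} uniq = ∼bag⇒↭ (unique∧set⇒bag (allFin⁺ n)
    (++⁺ uniq (filter⁺ (_∉? xs) (allFin⁺ n)) λ (v∈xs , v∈o) → ∈-others⁻ v∈o v∈xs)
    (mk⇔ split (λ _ → ∈-allFin _)))
    where
    split : ∀ {v} → v ∈ allFin n → v ∈ xs ++ others xs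
    split {v} _ with v ∈? xs
    ... | yes v∈xs = ∈-++⁺ˡ v∈xs
    ... | no v∉xs  = ∈-++⁺ʳ xs (∈-others⁺ v∉xs)

  sum-split : ∀ (f : Fin n → ℕ) {xs} → Unique xs →
              sum (map f (allFin n)) ≡ sum (map f xs) + sum (map f (others xs))
  sum-split f {xs} uniq = begin
    sum (map f (allFin n))                       ≡⟨ sum-↭ (map⁺ f (allFin↭ uniq)) ⟩
    sum (map f (xs ++ others xs))                ≡⟨ cong sum (map-++ f xs _) ⟩
    sum (map f xs ++ map f (others xs))          ≡⟨ sum-++ (map f xs) _ ⟩
    sum (map f xs) + sum (map f (others xs))     ∎
    where open ≡-Reasoning

  unique⇒length≤ : ∀ {xs : List (Fin n)} → Unique xs → length xs ≤ n
  unique⇒length≤ {xs} uniq = begin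
    length xs                        ≤⟨ m≤m+n _ _ ⟩
    length xs + length (others xs)   ≡⟨ length-++ xs ⟨
    length (xs ++ others xs)         ≡⟨ ↭-length (allFin↭ uniq) ⟨
    length (allFin n)                ≡⟨ length-tabulate {n = n} _ ⟩
    n                                ∎
    where open ≤-Reasoning

module _ {A : Set} (f : A → ℕ) where

  sum≡0⇒≡0 : ∀ {xs} → sum (map f xs) ≡ 0 → ∀ {x} → x ∈ xs → f x ≡ 0
  sum≡0⇒≡0 {x ∷ xs} eq (here refl) = m+n≡0⇒m≡0 (f x) eq
  sum≡0⇒≡0 {x ∷ xs} eq (there x∈) = sum≡0⇒≡0 (m+n≡0⇒n≡0 (f x) eq) x∈

  ≡0⇒sum≡0 : ∀ xs → (∀ {x} → x ∈ xs → f x ≡ 0) → sum (map f xs) ≡ 0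
  ≡0⇒sum≡0 [] _ = refl
  ≡0⇒sum≡0 (x ∷ xs) eq = cong₂ _+_ (eq (here refl)) (≡0⇒sum≡0 xs (eq ∘ there))

  -- Counting deficits turns a bound on a sum into an identity, so that equality can be read off
  -- from vanishing deficits.
  sum-deficit : ∀ {D} → (∀ x → f x ≤ D) → ∀ xs →
                sum (map f xs) + sum (map (λ x → D ∸ f x) xs) ≡ length xs * D
  sum-deficit f≤D [] = refl
  sum-deficit {D} f≤D (x ∷ xs) = begin
    (f x + s) + (D ∸ f x + t)    ≡⟨ lemma (f x) s (D ∸ f x) t ⟩
    (f x + (D ∸ f x)) + (s + t)  ≡⟨ cong₂ _+_ (m+[n∸m]≡n (f≤D x)) (sum-deficit f≤D xs) ⟩
    D + length xs * D            ∎
    where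
    open ≡-Reasoning
    s = sum (map f xs)
    t = sum (map (λ x → D ∸ f x) xs)
    lemma : ∀ a b c d → (a + b) + (c + d) ≡ (a + c) + (b + d)
    lemma = solve-∀

-- Deficits along a path

applyUpTo-cong : ∀ {A : Set} {f g : ℕ → A} m → (∀ {j} → j < m → f j ≡ g j) → applyUpTo f m ≡ applyUpTo g m
applyUpTo-cong zero eq = refl
applyUpTo-cong (suc m) eq = cong₂ _∷_ (eq (s≤s z≤n)) (applyUpTo-cong m (eq ∘ s≤s))

sum-applyUpTo-suc : ∀ (f : ℕ → ℕ) m → sum (applyUpTo (suc ∘ f) m) ≡ sum (applyUpTo f m) + m
sum-applyUpTo-suc f zero = refl
sum-applyUpTo-suc f (suc m) = begin
  suc (f 0 + sum (applyUpTo (suc ∘ f ∘ suc) m))  ≡⟨ cong (λ s → suc (f 0 + s)) (sum-applyUpTo-suc (f ∘ suc) m) ⟩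
  suc (f 0 + (sum (applyUpTo (f ∘ suc) m) + m))  ≡⟨ lemma (f 0) _ m ⟩
  f 0 + sum (applyUpTo (f ∘ suc) m) + suc m      ∎
  where
  open ≡-Reasoning
  lemma : ∀ a b c → suc (a + (b + c)) ≡ a + b + suc c
  lemma = solve-∀

-- The total deficit Σ (D − ecc) over the vertices of a path of length D = diam T.
pathDeficit : ℕ → ℕ
pathDeficit D = sum (applyUpTo (λ j → j ⊓ (D ∸ j)) (suc D))

-- The two ends contribute 0, and each of the `suc D` inner positions contributes one more than on
-- the path shorter by two.
pathDeficit-2+ : ∀ D → pathDeficit (2 + D) ≡ pathDeficit D + suc D
pathDeficit-2+ D = begin
  sum (applyUpTo f (2 + D))                                      ≡⟨ cong sum (applyUpTo-∷ʳ f (suc D)) ⟨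
  sum (applyUpTo f (suc D) ++ f (suc D) ∷ [])                     ≡⟨ sum-++ (applyUpTo f (suc D)) _ ⟩
  sum (applyUpTo f (suc D)) + (f (suc D) + 0)                    ≡⟨ cong₂ _+_ (cong sum (applyUpTo-cong (suc D) inner)) last ⟩
  sum (applyUpTo (λ j → suc (j ⊓ (D ∸ j))) (suc D)) + 0          ≡⟨ +-identityʳ _ ⟩
  sum (applyUpTo (λ j → suc (j ⊓ (D ∸ j))) (suc D))              ≡⟨ sum-applyUpTo-suc (λ j → j ⊓ (D ∸ j)) (suc D) ⟩
  pathDeficit D + suc D                                          ∎
  where
  open ≡-Reasoning
  f : ℕ → ℕ
  f j = suc j ⊓ (suc D ∸ j)
  inner : ∀ {j} → j < suc D → f j ≡ suc (j ⊓ (D ∸ j))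
  inner {j} j≤D = cong (suc j ⊓_) (+-∸-assoc 1 (s≤s⁻¹ j≤D))
  last : f (suc D) + 0 ≡ 0
  last = trans (+-identityʳ _) (cong (suc (suc D) ⊓_) (n∸n≡0 D))

pathDeficit-even : ∀ y → pathDeficit (2 * y) ≡ y * y
pathDeficit-even zero = refl
pathDeficit-even (suc y) = begin
  pathDeficit (2 * suc y)                ≡⟨ cong pathDeficit (*-suc 2 y) ⟩
  pathDeficit (2 + 2 * y)                ≡⟨ pathDeficit-2+ (2 * y) ⟩
  pathDeficit (2 * y) + suc (2 * y)      ≡⟨ cong (_+ suc (2 * y)) (pathDeficit-even y) ⟩
  y * y + suc (2 * y)                    ≡⟨ lemma y ⟩
  suc y * suc y                          ∎
  where
  open ≡-Reasoning
  lemma : ∀ y → y * y + suc (2 * y) ≡ suc y * suc y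
  lemma = solve-∀

-- The path deficit is `⌊D²/4⌋`; this is its lower bound without division, sharp for odd `D`. The
-- induction follows the recurrence in steps of two.
pathDeficit-≥ : ∀ D → D * D ≤ 1 + 4 * pathDeficit D
pathDeficit-≥ zero = z≤n
pathDeficit-≥ (suc zero) = ≤-refl
pathDeficit-≥ (suc (suc D)) = begin
  (2 + D) * (2 + D)                      ≡⟨ lemma₁ D ⟩
  D * D + 4 * suc D                      ≤⟨ +-monoˡ-≤ _ (pathDeficit-≥ D) ⟩
  1 + 4 * pathDeficit D + 4 * suc D      ≡⟨ lemma₂ (pathDeficit D) D ⟩
  1 + 4 * (pathDeficit D + suc D)        ≡⟨ cong (λ s → 1 + 4 * s) (pathDeficit-2+ D) ⟨
  1 + 4 * pathDeficit (2 + D)            ∎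
  where
  open ≤-Reasoning
  lemma₁ : ∀ D → (2 + D) * (2 + D) ≡ D * D + 4 * suc D
  lemma₁ = solve-∀
  lemma₂ : ∀ s D → 1 + 4 * s + 4 * suc D ≡ 1 + 4 * (s + suc D)
  lemma₂ = solve-∀

-- Eccentricities in a tree

module Eccentricity {n : ℕ} (T : Graph n) (tree : IsTree T)
                    (ecc : Fin n → ℕ) (isEcc : ∀ v → IsEcc T v (ecc v)) where
  open TreeMetric T tree public

  d≤ecc : ∀ v w → d v w ≤ ecc v
  d≤ecc v w = proj₂ (isEcc v) w _ (d-isDist v w)

  ecc-attained : ∀ v → ∃ λ w → d v w ≡ ecc v
  ecc-attained v with (w , dist) , _ ← isEcc v = w , sym (isDist⇒≡d dist)

  ecc≤ : ∀ {v m} → (∀ w → d v w ≤ m) → ecc v ≤ m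
  ecc≤ {v} bound with w , eq ← ecc-attained v = subst (_≤ _) eq (bound w)

  -- Such a path realises the diameter, since paths in a tree are geodesics.
  record Diametral (D : ℕ) (q : ℕ → Fin n) : Set where
    field
      path  : Path D q
      ecc≤D : ∀ v → ecc v ≤ D
  open Diametral public

  diametral-path : Fin n → ∃ λ D → ∃ (Diametral D)
  diametral-path u with v , max ← maximum u ecc with w , eq ← ecc-attained v =
    d v w , _ , record { path = geodesic-path v w ; ecc≤D = λ t → subst (ecc t ≤_) (sym eq) (max t) }

  -- Any path is a geodesic, so its length is at most an eccentricity and hence at most `D`.
  diametral⇒longest : ∀ {D q} → Diametral D q → IsLongestPath T (suc D) (q ∘ pred)
  diametral⇒longest {D} M = toIsPath (path M) , longest
    where
    longest : ∀ m z → IsPath T m z → m ≤ suc D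
    longest zero z _ = z≤n
    longest (suc m) z Q = s≤s (begin
      m                          ≡⟨ path-dist (fromIsPath Q) 0 m (≤-reflexive (+-identityʳ m)) ⟨
      d (z (suc (m + 0))) (z 1)  ≤⟨ d≤ecc _ _ ⟩
      ecc (z (suc (m + 0)))      ≤⟨ ecc≤D M _ ⟩
      D                          ∎)
      where open ≤-Reasoning

  -- Distances are lengths of geodesics, which are paths and so no longer than the longest one.
  longest⇒diametral : ∀ {D z} → IsLongestPath T (suc D) z → Diametral D (z ∘ suc)
  longest⇒diametral (Q , longest) .path = fromIsPath Q
  longest⇒diametral (Q , longest) .ecc≤D v =
    ecc≤ λ w → s≤s⁻¹ (longest _ _ (toIsPath (geodesic-path v w)))

  -- Eccentricities on a diametral path and the count of deficits

  module Diameter {D q} (M : Diametral D q) where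

    -- The two ends give the lower bound. For the upper one, the distance to `w` either rises from
    -- `q j` on to `q D` or has fallen all the way from `q 0`; a larger value at `q j` would push
    -- the distance at that end above `D`.
    ecc-on-path : ∀ {j} → j ≤ D → ecc (q j) ≡ j ⊔ (D ∸ j)
    ecc-on-path {j} j≤D = ≤-antisym (ecc≤ upper) (⊔-lub first last)
      where
      P = path M
      D∸j+j = m∸n+n≡m j≤D
      first : j ≤ ecc (q j)
      first = subst (_≤ ecc (q j))
        (trans (cong (λ i → d (q i) (q 0)) (sym (+-identityʳ j))) (path-dist P 0 j (subst (_≤ D) (sym (+-identityʳ j)) j≤D)))
        (d≤ecc (q j) (q 0))
      last : D ∸ j ≤ ecc (q j)
      last = subst (_≤ ecc (q j))
        (trans (d-sym (q j) _) (path-dist P j (D ∸ j) (≤-reflexive D∸j+j)))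
        (d≤ecc (q j) _)
      d≤D : ∀ v w → d v w ≤ D
      d≤D v w = ≤-trans (d≤ecc v w) (ecc≤D M v)
      upper : ∀ w → d (q j) w ≤ j ⊔ (D ∸ j)
      upper w with m≤n⇒m<n∨m≡n j≤D
      ... | inj₂ refl = ≤-trans (d≤D _ _) (m≤m⊔n _ _)
      ... | inj₁ j<D with ~⇒d±1 (edge P j<D) w
      ...   | inj₁ up = ≤-trans (+-cancelˡ-≤ (D ∸ j) _ _ (begin
                (D ∸ j) + d (q j) w    ≡⟨ ascend P up (D ∸ j) (≤-reflexive D∸j+j) ⟨
                d (q (D ∸ j + j)) w    ≤⟨ d≤D _ _ ⟩
                D                      ≡⟨ D∸j+j ⟨
                (D ∸ j) + j            ∎)) (m≤m⊔n _ _)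
              where open ≤-Reasoning
      ...   | inj₂ down = ≤-trans (+-cancelˡ-≤ j _ _ (begin
                j + d (q j) w          ≡⟨ descend P j<D down ⟨
                d (q 0) w              ≤⟨ d≤D _ _ ⟩
                D                      ≡⟨ m+[n∸m]≡n j≤D ⟨
                j + (D ∸ j)            ∎)) (m≤n⊔m _ _)
              where open ≤-Reasoning

    vertices : List (Fin n)
    vertices = applyUpTo q (suc D)

    vertices-unique : Unique vertices
    vertices-unique = applyUpTo⁺₁ q (suc D) λ i<j j≤D eq →
      <⇒≢ i<j (inj (path M) (≤-trans (<⇒≤ i<j) (s≤s⁻¹ j≤D)) (s≤s⁻¹ j≤D) eq)

    ∈-vertices⁺ : ∀ {j} → j ≤ D → q j ∈ vertices
    ∈-vertices⁺ j≤D = ∈-applyUpTo⁺ q (s≤s j≤D)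

    ∈-vertices⁻ : ∀ {v} → v ∈ vertices → ∃ λ j → j ≤ D × v ≡ q j
    ∈-vertices⁻ v∈ with j , s≤s j≤D , eq ← ∈-applyUpTo⁻ q v∈ = j , j≤D , eq

    D<n : D < n
    D<n = subst (_≤ n) (length-applyUpTo q (suc D)) (unique⇒length≤ vertices-unique)

    deficit : Fin n → ℕ
    deficit v = D ∸ ecc v

    total+deficit : totalEcc T ecc + sum (map deficit (allFin n)) ≡ n * D
    total+deficit = trans (sum-deficit ecc (ecc≤D M) (allFin n)) (cong (_* D) (length-tabulate {n = n} _))

    deficit-vertices : sum (map deficit vertices) ≡ pathDeficit D
    deficit-vertices = cong sum (trans (map-applyUpTo q deficit (suc D)) (applyUpTo-cong (suc D) pointwise))
      where
      pointwise : ∀ {j} → j < suc D → deficit (q j) ≡ j ⊓ (D ∸ j)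
      pointwise {j} (s≤s j≤D) = begin
        D ∸ ecc (q j)                 ≡⟨ cong (D ∸_) (ecc-on-path j≤D) ⟩
        D ∸ (j ⊔ (D ∸ j))             ≡⟨ ∸-distribˡ-⊔-⊓ D j (D ∸ j) ⟩
        (D ∸ j) ⊓ (D ∸ (D ∸ j))       ≡⟨ cong ((D ∸ j) ⊓_) (m∸[m∸n]≡n j≤D) ⟩
        (D ∸ j) ⊓ j                   ≡⟨ ⊓-comm (D ∸ j) j ⟩
        j ⊓ (D ∸ j)                   ∎
        where open ≡-Reasoning

    -- Adding `D` on the left and the equal `ecc u` on the right gives the same shape as for a leaf
    -- off the path, so one estimate serves both cases.
    count-on : ∀ {u} → ecc u ≡ D →
      totalEcc T ecc + (D + pathDeficit D + sum (map deficit (others vertices))) ≡ n * D + ecc u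
    count-on {u} eq = begin
      E + (D + pathDeficit D + R)          ≡⟨ lemma E D (pathDeficit D) R ⟩
      E + (pathDeficit D + R) + D          ≡⟨ cong (λ s → E + (s + R) + D) deficit-vertices ⟨
      E + (sum (map deficit vertices) + R) + D ≡⟨ cong (λ s → E + s + D) (sum-split deficit vertices-unique) ⟨
      E + sum (map deficit (allFin n)) + D ≡⟨ cong₂ _+_ total+deficit (sym eq) ⟩
      n * D + ecc u                        ∎
      where
      open ≡-Reasoning
      E = totalEcc T ecc
      R = sum (map deficit (others vertices))
      lemma : ∀ E D S R → E + (D + S + R) ≡ E + (S + R) + D
      lemma = solve-∀

    -- The deficit `D ∸ ecc u` is split off from the rest; moving `ecc u` to the right leaves `D` on
    -- the left.
    count-off : ∀ {u} → u ∉ vertices →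
      totalEcc T ecc + (D + pathDeficit D + sum (map deficit (others (u ∷ vertices)))) ≡ n * D + ecc u
    count-off {u} u∉ = begin
      E + (D + pathDeficit D + R)                        ≡⟨ cong (λ t → E + (t + pathDeficit D + R)) (m∸n+n≡m (ecc≤D M u)) ⟨
      E + (deficit u + ecc u + pathDeficit D + R)        ≡⟨ lemma E (deficit u) (ecc u) (pathDeficit D) R ⟩
      E + (deficit u + pathDeficit D + R) + ecc u        ≡⟨ cong (λ s → E + (deficit u + s + R) + ecc u) deficit-vertices ⟨
      E + (sum (map deficit (u ∷ vertices)) + R) + ecc u ≡⟨ cong (λ s → E + s + ecc u) (sum-split deficit (All.¬Any⇒All¬ vertices u∉ ∷ vertices-unique)) ⟨
      E + sum (map deficit (allFin n)) + ecc u           ≡⟨ cong (_+ ecc u) total+deficit ⟩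
      n * D + ecc u                                      ∎
      where
      open ≡-Reasoning
      E = totalEcc T ecc
      R = sum (map deficit (others (u ∷ vertices)))
      lemma : ∀ E δ e S R → E + (δ + e + S + R) ≡ E + (δ + S + R) + e
      lemma = solve-∀

  -- The leaf and its neighbour

  module Leaf (3≤n : 3 ≤ n) {u : Fin n} (leaf : IsLeaf T u) where

    private
      neighbour : ∃ λ c → u ~ c
      neighbour with w , w≢u , _ ← third 3≤n u u with d u w in eq
      ... | zero  = contradiction (sym (d≡0⇒≡ eq)) w≢u
      ... | suc _ with c , u~c , _ ← parent eq = c , u~c

    c : Fin n
    c = proj₁ neighbour

    u~c : u ~ c
    u~c = proj₂ neighbour

    private
      indicator : Fin n → ℕ
      indicator w = if adj T u w then 1 else 0

      indicator-~ : ∀ {w} → u ~ w → indicator w ≡ 1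
      indicator-~ e rewrite e = refl

    -- A second neighbour would make the degree sum at least 2.
    c-unique : ∀ {v} → u ~ v → v ≡ c
    c-unique {v} u~v with v Fin.≟ c
    ... | yes eq = eq
    ... | no v≢c = contradiction two (λ ())
      where
      open ≡-Reasoning
      R = sum (map indicator (others (v ∷ c ∷ [])))
      two : 1 ≡ 2 + R
      two = begin
        1                                      ≡⟨ leaf ⟨
        degree T u                             ≡⟨ sum-split indicator ((v≢c ∷ []) ∷ [] ∷ []) ⟩
        indicator v + (indicator c + 0) + R    ≡⟨ cong₂ (λ a b → a + (b + 0) + R) (indicator-~ u~v) (indicator-~ u~c) ⟩
        2 + R                                  ∎

    d-via-c : ∀ {w} → w ≢ u → d u w ≡ suc (d c w)
    d-via-c {w} w≢u with d u w in eq
    ... | zero  = contradiction (sym (d≡0⇒≡ eq)) w≢u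
    ... | suc _ with v , u~v , dv ← parent eq =
      cong suc (trans (sym dv) (cong (λ x → d x w) (c-unique u~v)))

    2≤ecc : 2 ≤ ecc u
    2≤ecc with w , w≢u , w≢c ← third 3≤n u c =
      ≤-trans (s≤s (n≢0⇒n>0 λ eq → w≢c (sym (d≡0⇒≡ eq)))) (subst (_≤ ecc u) (d-via-c w≢u) (d≤ecc u w))

    -- Every vertex other than `u` is one step nearer to `c` than to `u`; `u` itself is at distance
    -- at most 1, which `2≤ecc` covers.
    d-c≤ : ∀ w → d c w ≤ pred (ecc u)
    d-c≤ w with w Fin.≟ u
    ... | yes refl = ≤-trans (d-min (step (~-sym u~c) here)) (pred-mono-≤ 2≤ecc)
    ... | no w≢u   = pred-mono-≤ (subst (_≤ ecc u) (d-via-c w≢u) (d≤ecc u w))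

    ecc≤suc-c : ecc u ≤ suc (ecc c)
    ecc≤suc-c = ecc≤ λ w → ≤-trans (~⇒d≤ u~c w) (s≤s (d≤ecc c w))

    module _ {D q} (M : Diametral D q) where
      open Diameter M

      -- The detour through `c` joins the ends of the diametral path.
      D≤2∙pred : D ≤ 2 * pred (ecc u)
      D≤2∙pred = begin
        D                                ≡⟨ path-dist (path M) 0 D (≤-reflexive (+-identityʳ D)) ⟨
        d (q (D + 0)) (q 0)              ≤⟨ d-triangle _ c _ ⟩
        d (q (D + 0)) c + d c (q 0)      ≤⟨ +-mono-≤ (subst (_≤ _) (d-sym c _) (d-c≤ _)) (d-c≤ _) ⟩
        pred (ecc u) + pred (ecc u)      ≡⟨ cong (pred (ecc u) +_) (+-identityʳ _) ⟨
        2 * pred (ecc u)                 ∎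
        where open ≤-Reasoning

      on-path⇒ecc≡D : u ∈ vertices → ecc u ≡ D
      on-path⇒ecc≡D u∈ with ∈-vertices⁻ u∈
      ... | zero , j≤D , refl = ecc-on-path j≤D
      ... | suc j , j≤D , refl with m≤n⇒m<n∨m≡n j≤D
      ...   | inj₂ refl = trans (ecc-on-path j≤D) (trans (cong (suc j ⊔_) (n∸n≡0 j)) (⊔-identityʳ _))
      -- At an interior position the leaf would have two distinct neighbours on the path.
      ...   | inj₁ j<D = contradiction
                (inj (path M) (≤-trans (n≤1+n _) j≤D) j<D
                  (trans (c-unique (~-sym (edge (path M) j≤D))) (sym (c-unique (edge (path M) j<D)))))
                (m≢1+n+m j)

-- The two optimisation steps

-- Raising D to 2y gains (n − 1)(2y − D), more than the growth of the path deficit S ≈ D²/4.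
total-bound : ∀ E {D} S R n y → E + (D + S + R) ≡ n * D + suc y → D ≤ 2 * y → 2 + y ≤ n →
              D * D ≤ 1 + 4 * S → (D ≡ 2 * y → S ≡ y * y) →
              E + (y * y + 2 * y) ≤ n * (2 * y) + suc y ×
              (E + (y * y + 2 * y) ≡ n * (2 * y) + suc y → R ≡ 0 × D ≡ 2 * y)
total-bound E {D} S R n y count D≤2y 2+y≤n DD≤ even with m≤n⇒m<n∨m≡n D≤2y
... | inj₂ refl = m+n≤o⇒m≤o _ (≤-reflexive total) , λ eq → +-cancelˡ-≡ _ R 0 (trans total (trans (sym eq) (sym (+-identityʳ _)))) , refl
  where
  lemma : ∀ E y R → E + (y * y + 2 * y) + R ≡ E + (2 * y + y * y + R)
  lemma = solve-∀
  total : E + (y * y + 2 * y) + R ≡ n * (2 * y) + suc y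
  total = trans (lemma E y R) (trans (cong (λ s → E + (2 * y + s + R)) (sym (even refl))) count)
-- Here `2 * y = suc D + t` and `n = 2 + y + s`.
... | inj₁ D<2y with t , D+t≡2y ← m≤n⇒∃[o]m+o≡n D<2y with s , refl ← m≤n⇒∃[o]m+o≡n 2+y≤n =
  <⇒≤ strict , λ eq → contradiction eq (<⇒≢ strict)
  where
  split : ∀ E y → 4 * (E + (y * y + 2 * y)) ≡ 4 * E + (2 * y) * (2 * y) + 4 * (2 * y)
  split = solve-∀
  expand : ∀ E D t → 4 * E + (suc D + t) * (suc D + t) + 4 * (suc D + t)
         ≡ D * D + (4 * E + 4 * D + 2 * D * suc t + suc t * suc t + 4 * suc t)
  expand = solve-∀
  collect : ∀ E D S t → 1 + 4 * S + (4 * E + 4 * D + 2 * D * suc t + suc t * suc t + 4 * suc t) + 3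
          ≡ 4 * (E + (D + S)) + 2 * D * suc t + suc t * suc t + 4 * suc t + 4
  collect = solve-∀
  slack : ∀ E D S R t s → 4 * (E + (D + S)) + 2 * D * suc t + suc t * suc t + 4 * suc t + 4
        + (4 * R + suc t * suc t + 4 * s * suc t + 4 * t)
        ≡ 4 * (E + (D + S + R)) + (8 * suc t + 2 * (suc D + t) * suc t + 4 * s * suc t)
  slack = solve-∀
  merge : ∀ D y s t → 4 * ((2 + y + s) * D + suc y) + (8 * suc t + 2 * (2 * y) * suc t + 4 * s * suc t)
        ≡ 4 * ((2 + y + s) * (suc D + t) + suc y)
  merge = solve-∀
  strict : E + (y * y + 2 * y) < n * (2 * y) + suc y
  -- Multiplying by 4 lets the bound on `D * D` enter without division. The added 3 already gives
  -- strictness; the further slack in `R`, `s` and `t` is nonnegative.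
  strict = *-cancelˡ-< 4 _ _ (begin-strict
    4 * (E + (y * y + 2 * y))                            ≡⟨ split E y ⟩
    4 * E + (2 * y) * (2 * y) + 4 * (2 * y)              ≡⟨ cong (λ a → 4 * E + a * a + 4 * a) D+t≡2y ⟨
    4 * E + (suc D + t) * (suc D + t) + 4 * (suc D + t)  ≡⟨ expand E D t ⟩
    D * D + (4 * E + 4 * D + 2 * D * suc t + suc t * suc t + 4 * suc t)
      ≤⟨ +-monoˡ-≤ _ DD≤ ⟩
    1 + 4 * S + (4 * E + 4 * D + 2 * D * suc t + suc t * suc t + 4 * suc t)
      <⟨ m<m+n _ (s≤s z≤n) ⟩
    1 + 4 * S + (4 * E + 4 * D + 2 * D * suc t + suc t * suc t + 4 * suc t) + 3
      ≡⟨ collect E D S t ⟩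
    4 * (E + (D + S)) + 2 * D * suc t + suc t * suc t + 4 * suc t + 4
      ≤⟨ m≤m+n _ _ ⟩
    4 * (E + (D + S)) + 2 * D * suc t + suc t * suc t + 4 * suc t + 4
      + (4 * R + suc t * suc t + 4 * s * suc t + 4 * t)
      ≡⟨ slack E D S R t s ⟩
    4 * (E + (D + S + R)) + (8 * suc t + 2 * (suc D + t) * suc t + 4 * s * suc t)
      ≡⟨ cong₂ (λ a b → 4 * a + (8 * suc t + 2 * b * suc t + 4 * s * suc t)) count D+t≡2y ⟩
    4 * (n * D + suc y) + (8 * suc t + 2 * (2 * y) * suc t + 4 * s * suc t)
      ≡⟨ merge D y s t ⟩
    4 * (n * (suc D + t) + suc y)                        ≡⟨ cong (λ a → 4 * (n * a + suc y)) D+t≡2y ⟩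
    4 * (n * (2 * y) + suc y)                            ∎)
    where open ≤-Reasoning

private
  square-suc : ∀ e t δ → suc ((suc e + t) * (suc e + t)) + δ ≡ suc ((e + t) * (suc e + t)) + δ + (suc e + t)
  square-suc = solve-∀

-- e + N/e is minimal among integers e ≥ 1 at e = x: the difference of the two
-- sides is (e − x)(xe − N).
optimum : ∀ {x N} e → x * x < N + x → N < x * x + x →
          e ≡ x ⊎ e * x * x + e * N < x * (e * e + N)
optimum {x} {N} e lo hi with <-cmp e x
... | tri≈ _ e≡x _ = inj₁ e≡x
... | tri> _ _ x<e with t , refl ← m≤n⇒∃[o]m+o≡n x<e with δ , eq ← m≤n⇒∃[o]m+o≡n hi =
  -- With `e - x = suc t` and `x * e - N = x * t + suc δ`, the gap is their product. Adding
  -- `suc t * N` to both sides avoids subtraction.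
  inj₂ (m+n≤o⇒m≤o _ (≤-reflexive (+-cancelʳ-≡ (suc t * N) _ _ (trans (left x N t δ) (trans (cong (λ a → (suc x + t) * x * x + (suc x + t) * N + suc t * a + suc t * (x * t)) eq) (right x N t))))))
  where
  left : ∀ x N t δ → (suc ((suc x + t) * x * x + (suc x + t) * N) + (δ + t * suc δ + suc t * (x * t))) + suc t * N
       ≡ (suc x + t) * x * x + (suc x + t) * N + suc t * (suc N + δ) + suc t * (x * t)
  left = solve-∀
  right : ∀ x N t → (suc x + t) * x * x + (suc x + t) * N + suc t * (x * x + x) + suc t * (x * t)
        ≡ x * ((suc x + t) * (suc x + t) + N) + suc t * N
  right = solve-∀
... | tri< e<x _ _ with t , refl ← m≤n⇒∃[o]m+o≡n e<x with δ , eq ← m≤n⇒∃[o]m+o≡n lo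
  -- Solving `lo` for `N` eliminates it, so the gap `(x - e) * (N - x * e)` becomes a polynomial
  -- identity.
  with refl ← +-cancelʳ-≡ (suc e + t) N (suc ((e + t) * (suc e + t)) + δ) (trans (sym eq) (square-suc e t δ)) =
  inj₂ (m+n≤o⇒m≤o _ (≤-reflexive (gap e t δ)))
  where
  gap : ∀ e t δ → suc (e * (suc e + t) * (suc e + t) + e * (suc ((e + t) * (suc e + t)) + δ))
        + (δ + t * suc δ + suc t * ((suc e + t) * t))
      ≡ (suc e + t) * (e * e + (suc ((e + t) * (suc e + t)) + δ))
  gap = solve-∀

factor-out : ∀ x E N → x * E + (x * x * x + x * N) ≡ x * (E + (x * x + N))
factor-out = solve-∀

-- For positive `e`, division by `e * x` gives `E / e ≤ M - (e + N / e) ≤ M - (x + N / x)`. Equality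
-- needs both steps tight, and the second is tight only at `e ≡ x`.
ratio-bound : ∀ {x N} E e M → x * x < N + x → N < x * x + x → E + (e * e + N) ≤ M * e →
              x * E + (e * x * x + e * N) ≤ e * (M * x) ×
              (x * E + (e * x * x + e * N) ≡ e * (M * x) → e ≡ x × E + (e * e + N) ≡ M * e)
ratio-bound {x} {N} E e M lo hi bound = ans (optimum e lo hi)
  where
  swap : ∀ x M e → x * (M * e) ≡ e * (M * x)
  swap = solve-∀
  up : x * (E + (e * e + N)) ≤ e * (M * x)
  up = ≤-trans (*-monoʳ-≤ x bound) (≤-reflexive (swap x M e))
  x≢0 : ∀ {x N} → x * x < N + x → N < x * x + x → NonZero x
  x≢0 {zero} _ ()
  x≢0 {suc x} _ _ = _
  ans : e ≡ x ⊎ e * x * x + e * N < x * (e * e + N) →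
        x * E + (e * x * x + e * N) ≤ e * (M * x) ×
        (x * E + (e * x * x + e * N) ≡ e * (M * x) → e ≡ x × E + (e * e + N) ≡ M * e)
  ans (inj₁ refl) = ≤-trans (≤-reflexive (factor-out x E N)) up ,
    λ eq → refl , *-cancelˡ-≡ _ _ x {{x≢0 lo hi}} (trans (sym (factor-out x E N)) (trans eq (sym (swap x M x))))
  ans (inj₂ lt) = <⇒≤ strict , λ eq → contradiction eq (<⇒≢ strict)
    where
    strict : x * E + (e * x * x + e * N) < e * (M * x)
    strict = <-≤-trans (+-monoʳ-< (x * E) lt) (≤-trans (≤-reflexive (sym (*-distribˡ-+ x E _))) up)

-- The equality case

module Extremality {n : ℕ} (3≤n : 3 ≤ n) (T : Graph n) (tree : IsTree T)
                   (ecc : Fin n → ℕ) (isEcc : ∀ v → IsEcc T v (ecc v))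
                   {u : Fin n} (leaf : IsLeaf T u) where
  open Eccentricity T tree ecc isEcc
  open Leaf 3≤n leaf

  private
    E e y : ℕ
    E = totalEcc T ecc
    e = ecc u
    y = pred e

    suc-y : suc y ≡ e
    suc-y = suc-pred e {{>-nonZero (≤-trans (s≤s z≤n) 2≤ecc)}}

    -- Keeps the leaf off a diametral path of length `2 * y` once `y` is at least 2.
    ecc≡D⇒y≤1 : e ≡ 2 * y → y ≤ 1
    ecc≡D⇒y≤1 eq = +-cancelʳ-≤ y y 1 (≤-reflexive (trans (cong (y +_) (sym (+-identityʳ y))) (trans (sym eq) (sym suc-y))))

  -- Equality expressed by eccentricities, halfway between the numerical equality and the shape
  -- `Extremal`.
  record Tight (r : ℕ) (q : ℕ → Fin n) : Set where
    field
      diametral : Diametral (2 * r) q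
      off-path  : u ∉ Diameter.vertices diametral
      full      : ∀ {v} → v ≢ u → v ∉ Diameter.vertices diametral → ecc v ≡ 2 * r

  private
    y+2≤n : ∀ {D q} → Diametral D q → 2 + y ≤ n
    y+2≤n M = subst (λ a → suc a ≤ n) (sym suc-y) (≤-trans (s≤s (ecc≤D M u)) (Diameter.D<n M))

    bound : ∀ {D q} → Diametral D q → ∀ R → E + (D + pathDeficit D + R) ≡ n * D + e →
            E + (y * y + 2 * y) ≤ n * (2 * y) + suc y ×
            (E + (y * y + 2 * y) ≡ n * (2 * y) + suc y → R ≡ 0 × D ≡ 2 * y)
    bound {D} M R count = total-bound E (pathDeficit D) R n y (trans count (cong (n * D +_) (sym suc-y)))
      (D≤2∙pred M) (y+2≤n M) (pathDeficit-≥ D) (λ { refl → pathDeficit-even y })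

  -- Since `e = suc y`, this is `E ≤ (2n + 1)e - e² - (2n - 1)` without subtraction.
  total-≤ : E + (y * y + 2 * y) ≤ n * (2 * y) + suc y
  total-≤ with D , q , M ← diametral-path u with u ∈? Diameter.vertices M
  ... | yes u∈ = proj₁ (bound M _ (Diameter.count-on M (on-path⇒ecc≡D M u∈)))
  ... | no u∉  = proj₁ (bound M _ (Diameter.count-off M u∉))

  -- Equality forces `D = 2 * y` and leaves no deficit outside the path and the leaf. A leaf on the
  -- path would have eccentricity `2 * y`, too large for `y` at least 2.
  total-≡⇒tight : 2 ≤ y → E + (y * y + 2 * y) ≡ n * (2 * y) + suc y → ∃ (Tight y)
  total-≡⇒tight 2≤y eq with D , q , M ← diametral-path u with u ∈? Diameter.vertices M
  ... | yes u∈ with R≡0 , refl ← proj₂ (bound M _ (Diameter.count-on M (on-path⇒ecc≡D M u∈))) eq =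
    contradiction (≤-trans 2≤y (ecc≡D⇒y≤1 (on-path⇒ecc≡D M u∈))) (λ { (s≤s ()) })
  ... | no u∉ with R≡0 , refl ← proj₂ (bound M _ (Diameter.count-off M u∉)) eq =
    q , record
      { diametral = M
      ; off-path = u∉
      ; full = λ {v} v≢u v∉ → ≤-antisym (ecc≤D M v) (m∸n≡0⇒m≤n
          (sum≡0⇒≡0 (Diameter.deficit M) R≡0 (∈-others⁺ λ { (here eq) → v≢u eq ; (there v∈) → v∉ v∈ })))
      }

  tight⇒total-≡ : ∀ {q} → Tight y q → E + (y * y + 2 * y) ≡ n * (2 * y) + suc y
  tight⇒total-≡ {q} tight = begin
    E + (y * y + 2 * y)                        ≡⟨ cong (E +_) (lemma (y * y) (2 * y)) ⟩
    E + (2 * y + y * y + 0)                    ≡⟨ cong₂ (λ s r → E + (2 * y + s + r)) (pathDeficit-even y) R≡0 ⟨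
    E + (2 * y + pathDeficit (2 * y) + R)      ≡⟨ count-off off-path ⟩
    n * (2 * y) + e                            ≡⟨ cong (n * (2 * y) +_) suc-y ⟨
    n * (2 * y) + suc y                        ∎
    where
    open Tight tight
    open Diameter diametral
    open ≡-Reasoning
    R = sum (map deficit (others (u ∷ vertices)))
    lemma : ∀ a b → a + b ≡ b + a + 0
    lemma = solve-∀
    R≡0 : R ≡ 0
    R≡0 = ≡0⇒sum≡0 deficit (others (u ∷ vertices)) λ v∈ →
      m≤n⇒m∸n≡0 (≤-reflexive (sym (full (λ eq → ∈-others⁻ v∈ (here eq)) (λ p → ∈-others⁻ v∈ (there p)))))

  -- Seen from `v`, the attachment vertex is at distance 1. Moving on towards the far end cannot
  -- come nearer, as that would reach `v` itself, so the distance rises up to that end.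
  pendant-ecc : ∀ {m q} → Path (2 + m) q → ∀ {v} → (∀ {j} → j ≤ 2 + m → q j ≢ v) →
                v ~ q 1 ⊎ v ~ q (suc m) → 2 + m ≤ ecc v
  pendant-ecc {m} {q} P {v} v∉ hang = go hang
    where
    open ≤-Reasoning
    near : ∀ {j} → j ≤ 2 + m → v ~ q j → d (q j) v ≡ 1
    near j≤ v~ = ≤-antisym (d-min (step (~-sym v~) here)) (n≢0⇒n>0 (v∉ j≤ ∘ d≡0⇒≡))
    not-here : ∀ {i j} → i ≤ 2 + m → j ≤ 2 + m → v ~ q j → d (q j) v ≢ suc (d (q i) v)
    not-here i≤ j≤ v~ eq = v∉ i≤ (d≡0⇒≡ (suc-injective (trans (sym eq) (near j≤ v~))))
    go : v ~ q 1 ⊎ v ~ q (suc m) → 2 + m ≤ ecc v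
    go (inj₁ v~) with ~⇒d±1 (edge P {1} (s≤s (s≤s z≤n))) v
    ... | inj₂ eq = contradiction eq (not-here (s≤s (s≤s z≤n)) (s≤s z≤n) v~)
    ... | inj₁ up = begin
      2 + m                    ≡⟨ +-comm 1 (suc m) ⟩
      suc m + 1                ≡⟨ cong (suc m +_) (near (s≤s z≤n) v~) ⟨
      suc m + d (q 1) v        ≡⟨ ascend P up (suc m) (≤-reflexive (+-comm (suc m) 1)) ⟨
      d (q (suc m + 1)) v      ≡⟨ d-sym _ v ⟩
      d v (q (suc m + 1))      ≤⟨ d≤ecc v _ ⟩
      ecc v                    ∎
    go (inj₂ v~) with ~⇒d±1 (edge P {m} (n≤1+n _)) v
    ... | inj₁ eq = contradiction eq (not-here (m≤n+m m 2) (n≤1+n _) v~)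
    ... | inj₂ down = begin
      2 + m                        ≡⟨ +-comm 2 m ⟩
      m + 2                        ≡⟨ cong (λ a → m + suc a) (near (n≤1+n _) v~) ⟨
      m + suc (d (q (suc m)) v)    ≡⟨ cong (m +_) down ⟨
      m + d (q m) v                ≡⟨ descend P (n≤1+n _) down ⟨
      d (q 0) v                    ≡⟨ d-sym _ v ⟩
      d v (q 0)                    ≤⟨ d≤ecc v _ ⟩
      ecc v                        ∎

  tight⇒extremal : ∀ {q} → 2 ≤ y → Tight y q → Extremal T u (suc y)
  tight⇒extremal {q} 2≤y tight =
    -- `Extremal` numbers the path from 1 and `q` from 0, so position `suc y` is `q y`.
    q ∘ pred ,
    subst (λ m → IsLongestPath T m (q ∘ pred)) (sym 2x∸1) (diametral⇒longest diametral) ,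
    subst (u ~_) c≡ u~c ,
    λ v v≢u v∉ → Sum.map₂ (subst (λ m → v ~ q (pred m)) (sym 2x∸2))
      (attached v≢u λ v∈ → let j , j≤ , eq = ∈-vertices⁻ v∈ in
        v∉ (suc j , s≤s z≤n , ≤-trans (s≤s j≤) (≤-reflexive (sym 2x∸1)) , sym eq))
    where
    open Tight tight
    open Diameter diametral
    2x∸1 : 2 * suc y ∸ 1 ≡ suc (2 * y)
    2x∸1 = cong (_∸ 1) (*-suc 2 y)
    2x∸2 : 2 * suc y ∸ 2 ≡ 2 * y
    2x∸2 = cong (_∸ 2) (*-suc 2 y)
    y≤2y : y ≤ 2 * y
    y≤2y = m≤m+n y _
    2y≡ : y + y ≡ 2 * y
    2y≡ = cong (y +_) (sym (+-identityʳ y))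
    2y≰y : ¬ (2 * y ≤ y)
    2y≰y le = contradiction (≤-trans 2≤y (+-cancelʳ-≤ y y 0 (subst (_≤ y) (sym 2y≡) le))) (λ ())

    c∈ : c ∈ vertices
    c∈ with c ∈? vertices
    ... | yes p = p
    -- Off the path `c` would have eccentricity `2 * y`, but it has at most `y`.
    ... | no c∉ = contradiction (subst (_≤ y) (full (~⇒≢ (~-sym u~c)) c∉) (ecc≤ d-c≤)) 2y≰y

    c≡ : c ≡ q y
    c≡ with j , j≤ , eq ← ∈-vertices⁻ c∈ =
      -- Only the midpoint satisfies `j ⊔ (2 * y ∸ j) ≤ y`.
      trans eq (cong q (≤-antisym (m⊔n≤o⇒m≤o j _ ⊔≤y) (+-cancelˡ-≤ y y j (begin
        y + y                   ≡⟨ 2y≡ ⟩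
        2 * y                   ≡⟨ m∸n+n≡m j≤ ⟨
        (2 * y ∸ j) + j         ≤⟨ +-monoˡ-≤ j (m⊔n≤o⇒n≤o j _ ⊔≤y) ⟩
        y + j                   ∎))))
      where
      open ≤-Reasoning
      ⊔≤y : j ⊔ (2 * y ∸ j) ≤ y
      ⊔≤y = subst (_≤ y) (trans (cong ecc eq) (ecc-on-path j≤)) (ecc≤ d-c≤)

    centre : ∀ w → d (q y) w ≤ y
    centre w = subst (λ x → d x w ≤ y) c≡ (d-c≤ w)

    -- A vertex at distance `2 * y` from `v` is reached through the centre, with at most `y` on each
    -- side, so both halves are exact.
    far : ∀ {v} → v ≢ u → v ∉ vertices → d v (q y) ≡ y
    far {v} v≢u v∉ with w , eq ← ecc-attained v =
      ≤-antisym (subst (_≤ y) (d-sym (q y) v) (centre v)) (+-cancelʳ-≤ y y _ (begin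
        y + y                      ≡⟨ 2y≡ ⟩
        2 * y                      ≡⟨ full v≢u v∉ ⟨
        ecc v                      ≡⟨ eq ⟨
        d v w                      ≤⟨ d-triangle v (q y) w ⟩
        d v (q y) + d (q y) w      ≤⟨ +-monoʳ-≤ _ (centre w) ⟩
        d v (q y) + y              ∎))
      where open ≤-Reasoning

    suc-pred-y : suc (pred y) ≡ y
    suc-pred-y = suc-pred y {{>-nonZero (≤-trans (s≤s z≤n) 2≤y)}}

    position : ∀ {j} → j ≤ 2 * y → d (q j) (q y) ≡ pred y → j ≡ 1 ⊎ j ≡ pred (2 * y)
    position {j} j≤ dj with ≤-total j y
    ... | inj₁ j≤y = inj₁ (∸-cancelˡ-≡ j≤y (≤-trans (s≤s z≤n) 2≤y) (begin
      y ∸ j                          ≡⟨ path-dist (path diametral) j (y ∸ j) (subst (_≤ 2 * y) (sym (m∸n+n≡m j≤y)) y≤2y) ⟨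
      d (q ((y ∸ j) + j)) (q j)      ≡⟨ cong (λ i → d (q i) (q j)) (m∸n+n≡m j≤y) ⟩
      d (q y) (q j)                  ≡⟨ d-sym (q y) (q j) ⟩
      d (q j) (q y)                  ≡⟨ dj ⟩
      y ∸ 1                          ∎))
      where open ≡-Reasoning
    ... | inj₂ y≤j = inj₂ (begin
      j                              ≡⟨ m∸n+n≡m y≤j ⟨
      (j ∸ y) + y                    ≡⟨ cong (_+ y) (path-dist (path diametral) y (j ∸ y) (subst (_≤ 2 * y) (sym (m∸n+n≡m y≤j)) j≤)) ⟨
      d (q ((j ∸ y) + y)) (q y) + y  ≡⟨ cong (λ i → d (q i) (q y) + y) (m∸n+n≡m y≤j) ⟩
      d (q j) (q y) + y              ≡⟨ cong (_+ y) dj ⟩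
      pred y + y                     ≡⟨ cong (λ a → pred (a + y)) suc-pred-y ⟩
      pred (y + y)                   ≡⟨ cong pred 2y≡ ⟩
      pred (2 * y)                   ∎)
      where open ≡-Reasoning

    -- The next vertex on the way to the centre is too close to it to be off the path.
    next∈ : ∀ {v v′} → v ∉ vertices → v ~ v′ → d v′ (q y) ≡ pred y → v′ ∈ vertices
    next∈ {v} {v′} v∉ v~v′ dv′ with v′ ∈? vertices
    ... | yes v′∈ = v′∈
    ... | no v′∉ = contradiction (trans (sym (far v′≢u v′∉)) dv′) (λ eq → 1+n≢n (trans suc-pred-y eq))
      where
      v′≢u : v′ ≢ u
      -- A neighbour of the leaf is `c`, which lies on the path.
      v′≢u refl = v∉ (subst (_∈ vertices) (sym (c-unique (~-sym v~v′))) c∈)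

    attached : ∀ {v} → v ≢ u → v ∉ vertices → v ~ q 1 ⊎ v ~ q (pred (2 * y))
    attached {v} v≢u v∉ =
      let v′ , v~v′ , dv′ = parent (trans (far v≢u v∉) (sym suc-pred-y))
          j , j≤ , v′≡ = ∈-vertices⁻ (next∈ v∉ v~v′ dv′)
          v~qj = subst (v ~_) v′≡ v~v′
      in Sum.map (λ eq → subst (λ i → v ~ q i) eq v~qj) (λ eq → subst (λ i → v ~ q i) eq v~qj)
           (position j≤ (trans (cong (λ x → d x (q y)) (sym v′≡)) dv′))

  -- The neighbour `c` is the centre, of eccentricity `r`, so `y ≤ r`; the diameter `2 * r` is at
  -- most `2 * y`, so `r ≤ y`. The attached vertices see the whole path.
  extremal⇒tight : ∀ {r} → 2 ≤ r → Extremal T u (suc r) → y ≡ r × ∃ (Tight y)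
  extremal⇒tight {r} 2≤r (z , longest , u~z , adjacent) = y≡r , q , subst (λ r → Tight r q) (sym y≡r) tight
    where
    q : ℕ → Fin n
    q = z ∘ suc
    2x∸1 : 2 * suc r ∸ 1 ≡ suc (2 * r)
    2x∸1 = cong (_∸ 1) (*-suc 2 r)
    2x∸2 : 2 * suc r ∸ 2 ≡ 2 * r
    2x∸2 = cong (_∸ 2) (*-suc 2 r)
    M : Diametral (2 * r) q
    M = longest⇒diametral (subst (λ m → IsLongestPath T m z) 2x∸1 longest)
    open Diameter M

    ecc-c : ecc c ≡ r
    ecc-c = begin
      ecc c              ≡⟨ cong ecc (c-unique u~z) ⟨
      ecc (q r)          ≡⟨ ecc-on-path (m≤m+n r _) ⟩
      r ⊔ (2 * r ∸ r)    ≡⟨ cong (r ⊔_) (trans (m+n∸m≡n r (r + 0)) (+-identityʳ r)) ⟩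
      r ⊔ r              ≡⟨ ⊔-idem r ⟩
      r                  ∎
      where open ≡-Reasoning
    y≡r : y ≡ r
    y≡r = ≤-antisym (subst (y ≤_) ecc-c (pred-mono-≤ ecc≤suc-c)) (*-cancelˡ-≤ 2 (D≤2∙pred M))

    off : u ∉ vertices
    off u∈ = contradiction
      (≤-trans (subst (2 ≤_) (sym y≡r) 2≤r)
        (ecc≡D⇒y≤1 (trans (on-path⇒ecc≡D M u∈) (cong (2 *_) (sym y≡r)))))
      (λ { (s≤s ()) })

    tight : Tight r q
    tight = record
      { diametral = M
      ; off-path = off
      ; full = λ {v} v≢u v∉ → ≤-antisym (ecc≤D M v) (far v≢u v∉)
      }
      where
      far : ∀ {v} → v ≢ u → v ∉ vertices → 2 * r ≤ ecc v
      far {v} v≢u v∉ with m , eq ← m≤n⇒∃[o]m+o≡n (≤-trans 2≤r (m≤m+n r _)) =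
        subst (_≤ ecc v) eq (pendant-ecc (subst (λ D → Path D q) (sym eq) (path M))
          (λ j≤ eq′ → v∉ (subst (_∈ vertices) eq′ (∈-vertices⁺ (≤-trans j≤ (≤-reflexive eq)))))
          (Sum.map₂ (subst (λ k → v ~ z k) (trans 2x∸2 (sym eq)))
            (adjacent v v≢u λ { (suc j , _ , j≤ , eq′) →
              v∉ (subst (_∈ vertices) eq′ (∈-vertices⁺ (s≤s⁻¹ (≤-trans j≤ (≤-reflexive 2x∸1))))) })))

  ratio-≤ : ∀ {x N} → 3 ≤ x → 2 * n ≡ suc N → x * x < N + x → N < x * x + x →
            x * E + (e * x * x + e * N) ≤ e * ((2 * n + 1) * x) ×
            (x * E + (e * x * x + e * N) ≡ e * ((2 * n + 1) * x) ⇔ Extremal T u x)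
  ratio-≤ {suc r} {N} (s≤s 2≤r) 2n≡ lo hi = proj₁ ratio , mk⇔ to from
    where
    open ≡-Reasoning
    left-lemma : ∀ E y N → E + (y * y + 2 * y) + suc N ≡ E + (suc y * suc y + N)
    left-lemma = solve-∀
    right-lemma : ∀ n y → n * (2 * y) + suc y + 2 * n ≡ (2 * n + 1) * suc y
    right-lemma = solve-∀
    -- Adding `suc N`, which is `2 * n`, completes the square `y * y + 2 * y + 1 = e * e`.
    left : E + (y * y + 2 * y) + suc N ≡ E + (e * e + N)
    left = trans (left-lemma E y N) (cong (λ a → E + (a * a + N)) suc-y)
    right : n * (2 * y) + suc y + suc N ≡ (2 * n + 1) * e
    right = trans (cong (n * (2 * y) + suc y +_) (sym 2n≡)) (trans (right-lemma n y) (cong ((2 * n + 1) *_) suc-y))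
    ratio = ratio-bound {suc r} {N} E e (2 * n + 1) lo hi (subst₂ _≤_ left right (+-monoˡ-≤ (suc N) total-≤))

    to : suc r * E + (e * suc r * suc r + e * N) ≡ e * ((2 * n + 1) * suc r) → Extremal T u (suc r)
    to eq =
      let e≡ , total-≡ = proj₂ ratio eq
          y≡r = cong pred e≡
          2≤y = subst (2 ≤_) (sym y≡r) 2≤r
          _ , tight = total-≡⇒tight 2≤y (+-cancelʳ-≡ (suc N) _ _ (trans left (trans total-≡ (sym right))))
      in subst (Extremal T u ∘ suc) y≡r (tight⇒extremal 2≤y tight)

    from : Extremal T u (suc r) → suc r * E + (e * suc r * suc r + e * N) ≡ e * ((2 * n + 1) * suc r)
    from ext with y≡r , _ , tight ← extremal⇒tight 2≤r ext = begin
      suc r * E + (e * suc r * suc r + e * N)  ≡⟨ cong (λ x → x * E + (e * x * x + e * N)) x≡e ⟩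
      e * E + (e * e * e + e * N)              ≡⟨ factor-out e E N ⟩
      e * (E + (e * e + N))                    ≡⟨ cong (e *_) left ⟨
      e * (E + (y * y + 2 * y) + suc N)        ≡⟨ cong (λ a → e * (a + suc N)) (tight⇒total-≡ tight) ⟩
      e * (n * (2 * y) + suc y + suc N)        ≡⟨ cong (e *_) right ⟩
      e * ((2 * n + 1) * e)                    ≡⟨ cong (λ x → e * ((2 * n + 1) * x)) x≡e ⟨
      e * ((2 * n + 1) * suc r)                ∎
      where
      x≡e : suc r ≡ e
      x≡e = trans (cong suc (sym y≡r)) suc-y

-- Parity, and the passage from naturals to integers

pronic-even : ∀ k → ∃ λ h → k * k + k ≡ 2 * h
pronic-even zero = 0 , refl
pronic-even (suc k) with h , eq ← pronic-even k = h + suc k , trans (lemma₁ k) (trans (cong (_+ 2 * suc k) eq) (sym (*-distribˡ-+ 2 h (suc k))))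
  where
  lemma₁ : ∀ k → suc k * suc k + suc k ≡ k * k + k + 2 * suc k
  lemma₁ = solve-∀

open import Data.Integer using (ℤ; +_; +≤+; -_) renaming (_*_ to _*ℤ_; _+_ to _+ℤ_; _-_ to _-ℤ_; _≤_ to _≤ℤ_)
import Data.Integer.Properties as ℤ
import Data.Integer.Tactic.RingSolver as ℤ-Solver

module _ (x E e M A B : ℕ) where
  private
    -- Everything subtracted in the integer statement; moving it across gives the form over the
    -- naturals.
    Q : ℕ
    Q = e * (A + B)

    difference : (+ e) *ℤ ((+ M) *ℤ (+ x) -ℤ (+ A) -ℤ (+ B)) ≡ (+ (e * (M * x))) -ℤ (+ Q)
    difference = begin
      (+ e) *ℤ ((+ M) *ℤ (+ x) -ℤ (+ A) -ℤ (+ B))                ≡⟨ distrib (+ e) ((+ M) *ℤ (+ x)) (+ A) (+ B) ⟩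
      (+ e) *ℤ ((+ M) *ℤ (+ x)) -ℤ (+ e) *ℤ ((+ A) +ℤ (+ B))     ≡⟨ cong₂ (λ a b → (+ e) *ℤ a -ℤ b) (ℤ.pos-* M x) (ℤ.pos-* e (A + B)) ⟨
      (+ e) *ℤ (+ (M * x)) -ℤ (+ Q)                              ≡⟨ cong (_-ℤ (+ Q)) (ℤ.pos-* e (M * x)) ⟨
      (+ (e * (M * x))) -ℤ (+ Q)                                 ∎
      where
      open ≡-Reasoning
      distrib : ∀ e m a b → e *ℤ (m -ℤ a -ℤ b) ≡ e *ℤ m -ℤ e *ℤ (a +ℤ b)
      distrib = ℤ-Solver.solve-∀

    shift : (+ x) *ℤ (+ E) ≡ (+ (x * E + Q)) -ℤ (+ Q)
    shift = begin
      (+ x) *ℤ (+ E)                          ≡⟨ ℤ.pos-* x E ⟨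
      + (x * E)                               ≡⟨ cancel (+ (x * E)) (+ Q) ⟩
      (+ (x * E)) +ℤ (+ Q) -ℤ (+ Q)           ∎
      where
      open ≡-Reasoning
      cancel : ∀ a b → a ≡ a +ℤ b -ℤ b
      cancel = ℤ-Solver.solve-∀

    minus-injective : ∀ {a b} → (+ a) -ℤ (+ Q) ≡ (+ b) -ℤ (+ Q) → a ≡ b
    minus-injective {a} {b} eq = ℤ.+-injective (begin
      + a                         ≡⟨ restore (+ a) (+ Q) ⟩
      (+ a) -ℤ (+ Q) +ℤ (+ Q)     ≡⟨ cong (_+ℤ (+ Q)) eq ⟩
      (+ b) -ℤ (+ Q) +ℤ (+ Q)     ≡⟨ restore (+ b) (+ Q) ⟨
      + b                         ∎)
      where
      open ≡-Reasoning
      restore : ∀ a b → a ≡ a -ℤ b +ℤ b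
      restore = ℤ-Solver.solve-∀

  ≤⇒≤ℤ : x * E + e * (A + B) ≤ e * (M * x) →
         (+ x) *ℤ (+ E) ≤ℤ (+ e) *ℤ ((+ M) *ℤ (+ x) -ℤ (+ A) -ℤ (+ B))
  ≤⇒≤ℤ le = subst₂ _≤ℤ_ (sym shift) (sym difference) (ℤ.+-monoˡ-≤ (- (+ Q)) (+≤+ le))

  ≡ℤ⇔≡ : ((+ x) *ℤ (+ E) ≡ (+ e) *ℤ ((+ M) *ℤ (+ x) -ℤ (+ A) -ℤ (+ B))) ⇔ (x * E + e * (A + B) ≡ e * (M * x))
  ≡ℤ⇔≡ = mk⇔ (λ eq → minus-injective (trans (sym shift) (trans eq difference)))
             (λ eq → trans shift (trans (cong (λ a → (+ a) -ℤ (+ Q)) eq) (sym difference)))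

-- The two ranges of `i`

theorem2p3 : (n : ℕ) → 8 ≤ n → (T : Graph n) → IsTree T →
    (ecc : Fin n → ℕ) → (∀ v → IsEcc T v (ecc v)) →
    (k i : ℕ) → i ≤ 2 * k → 2 * n ≡ k * k + i + 1 →
    (u : Fin n) → IsLeaf T u →
    ((i ≤ k →
    ((+ k) *ℤ (+ totalEcc T ecc) ≤ℤ (+ ecc u) *ℤ ((+ (2 * n + 1)) *ℤ (+ k) -ℤ (+ (2 * k * k)) -ℤ (+ i)))
    × (((+ k) *ℤ (+ totalEcc T ecc) ≡ (+ ecc u) *ℤ ((+ (2 * n + 1)) *ℤ (+ k) -ℤ (+ (2 * k * k)) -ℤ (+ i)))
    ⇔ Extremal T u k))
    × (k + 1 ≤ i →
    ((+ (k + 1)) *ℤ (+ totalEcc T ecc) ≤ℤ (+ ecc u) *ℤ ((+ (2 * n + 1)) *ℤ (+ (k + 1)) -ℤ (+ (2 * k * (k + 1))) -ℤ (+ (i + 1))))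
    × (((+ (k + 1)) *ℤ (+ totalEcc T ecc) ≡ (+ ecc u) *ℤ ((+ (2 * n + 1)) *ℤ (+ (k + 1)) -ℤ (+ (2 * k * (k + 1))) -ℤ (+ (i + 1))))
    ⇔ Extremal T u (k + 1))))
theorem2p3 n 8≤n T tree ecc isEcc k i i≤2k 2n≡ u leaf = small , large
  where
  N = k * k + i

  2n≡sucN : 2 * n ≡ suc N
  2n≡sucN = trans 2n≡ (+-comm N 1)

  open Extremality (≤-trans (m≤m+n 3 5) 8≤n) T tree ecc isEcc leaf

  -- Both ranges split `x * x + N` as `A + B` so that `A / x = 2k`, while `B / x` is the fraction in
  -- the bound.
  statement : ∀ x A B → ecc u * (A + B) ≡ ecc u * x * x + ecc u * N →
    3 ≤ x → x * x < N + x → N < x * x + x →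
    ((+ x) *ℤ (+ totalEcc T ecc) ≤ℤ (+ ecc u) *ℤ ((+ (2 * n + 1)) *ℤ (+ x) -ℤ (+ A) -ℤ (+ B)))
    × (((+ x) *ℤ (+ totalEcc T ecc) ≡ (+ ecc u) *ℤ ((+ (2 * n + 1)) *ℤ (+ x) -ℤ (+ A) -ℤ (+ B)))
    ⇔ Extremal T u x)
  statement x A B eq 3≤x lo hi =
    let M = 2 * n + 1
        le , iff = subst (λ s → x * totalEcc T ecc + s ≤ ecc u * (M * x) ×
                                (x * totalEcc T ecc + s ≡ ecc u * (M * x) ⇔ Extremal T u x))
                         (sym eq) (ratio-≤ 3≤x 2n≡sucN lo hi)
    in ≤⇒≤ℤ x _ (ecc u) M A B le , iff ⇔-∘ ≡ℤ⇔≡ x _ (ecc u) M A B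

  -- For `k ≤ 2` the right side of `2n≡` is at most 9, yet `2 * n` is at least 16. The equality case
  -- needs `x` at least 3.
  3≤k : 3 ≤ k
  3≤k with 3 ≤? k
  ... | yes p = p
  ... | no k≱3 = contradiction (begin
      16                       ≤⟨ *-monoʳ-≤ 2 8≤n ⟩
      2 * n                    ≡⟨ 2n≡ ⟩
      k * k + i + 1            ≤⟨ +-monoˡ-≤ 1 (+-mono-≤ (*-mono-≤ k≤2 k≤2) (≤-trans i≤2k (*-monoʳ-≤ 2 k≤2))) ⟩
      9                        ∎) (<⇒≱ (m≤m+n 10 6))
    where
    open ≤-Reasoning
    k≤2 = s≤s⁻¹ (≰⇒> k≱3)

  -- i = k would make 2n = k(k+1) + 1 odd.
  i≢k : i ≢ k
  i≢k refl with h , eq ← pronic-even k = even≢odd n h (trans 2n≡sucN (cong suc eq))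

  -- For `x = k` the upper condition on `N` is `i < k`, strict by `i≢k`.
  small = λ i≤k → statement k (2 * k * k) i (lemma (ecc u) k i) 3≤k
    (≤-<-trans (m≤m+n (k * k) i) (m<m+n N (≤-trans (s≤s z≤n) 3≤k)))
    (+-monoʳ-< (k * k) (≤∧≢⇒< i≤k i≢k))
    where
    lemma : ∀ e k i → e * (2 * k * k + i) ≡ e * k * k + e * (k * k + i)
    lemma = solve-∀

  -- For `x = k + 1` the lower condition on `N` is exactly `k + 1 ≤ i`; the upper one follows from
  -- `i ≤ 2 * k`.
  large = λ k<i → statement (k + 1) (2 * k * (k + 1)) (i + 1) (lemma (ecc u) k i) (≤-trans 3≤k (m≤m+n k 1))
    (lo k<i) hi
    where
    open ≤-Reasoning
    lemma : ∀ e k i → e * (2 * k * (k + 1) + (i + 1)) ≡ e * (k + 1) * (k + 1) + e * (k * k + i)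
    lemma = solve-∀
    lo-lemma : ∀ k → suc ((k + 1) * (k + 1)) ≡ k * k + (k + 1) + (k + 1)
    lo-lemma = solve-∀
    lo : k + 1 ≤ i → (k + 1) * (k + 1) < N + (k + 1)
    lo k<i = ≤-trans (≤-reflexive (lo-lemma k)) (+-monoˡ-≤ (k + 1) (+-monoʳ-≤ (k * k) k<i))
    hi-lemma : ∀ k → suc (k * k + 2 * k) + (k + 1) ≡ (k + 1) * (k + 1) + (k + 1)
    hi-lemma = solve-∀
    hi : N < (k + 1) * (k + 1) + (k + 1)
    hi = ≤-trans (s≤s (+-monoʳ-≤ (k * k) i≤2k)) (≤-trans (m≤m+n _ (k + 1)) (≤-reflexive (hi-lemma k)))
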